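{- Let $n,c$ be positive integers and $k=c\cdot n$. Then $F(k,n)=c+n-1$.
   Context: Clear Mastermind with $n\ge 1$ positions and $k\ge 1$ codes: write $[k]=\{1,\dots,k\}$. A codemaker fixes a secret answer $y=(y_1,\dots,y_n)\in[k]^n$. In each round the codebreaker submits a guess $x\in[k]^n$ (any string, chosen adaptively from previous guesses and feedback) and receives feedback $\pi(x,y)\in\{\mathrm{G},\mathrm{Y},\mathrm{B}\}^n$ defined as follows: for every position $i$ with $x_i=y_i$, $\pi_i=\mathrm{G}$. Let $M$ be the multiset $\{y_i : x_i\ne y_i\}$ of answer codes at non-G positions. Then scan the non-G positions $j$ in increasing order: if $x_j$ currently occurs in $M$, set $\pi_j=\mathrm{Y}$ and remove one copy of $x_j$ from $M$; otherwise set $\pi_j=\mathrm{B}$. The codebreaker finds the answer in $m$ rounds if her $m$-th guess equals $y$. $F(k,n)$ is the least $m$ such that the codebreaker has a strategy that, for every answer $y\in[k]^n$, makes a guess equal to $y$ within the first $m$ rounds. -}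

module Defs where

open import Data.Nat using (ℕ; zero; suc; _<_)
open import Data.Fin using (Fin; _≟_)
open import Data.Vec using (Vec; []; _∷_)
open import Data.List using (List; []; _∷_; _++_; [_])
open import Data.List.Relation.Unary.Any using (Any)
open import Data.Maybe using (Maybe; just; nothing)
open import Data.Product using (_×_; _,_; proj₁; ∃)
open import Relation.Nullary using (¬_; yes; no)
open import Relation.Binary.PropositionalEquality using (_≡_)

data Colour : Set where
  G Y B : Colour

Code : ℕ → ℕ → Set
Code k n = Vec (Fin k) n

removeOne : ∀ {k} → Fin k → List (Fin k) → Maybe (List (Fin k))
removeOne a [] = nothing
removeOne a (b ∷ bs) with a ≟ b
... | yes _ = just bs
... | no _ with removeOne a bs
...   | just bs' = just (b ∷ bs')
...   | nothing = nothing

-- the multiset M = { y_i : x_i ≠ y_i }, as a list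
nonGreen : ∀ {k n} → Code k n → Code k n → List (Fin k)
nonGreen [] [] = []
nonGreen (x ∷ xs) (y ∷ ys) with x ≟ y
... | yes _ = nonGreen xs ys
... | no _ = y ∷ nonGreen xs ys

scan : ∀ {k n} → List (Fin k) → Code k n → Code k n → Vec Colour n
scan M [] [] = []
scan M (x ∷ xs) (y ∷ ys) with x ≟ y
... | yes _ = G ∷ scan M xs ys
... | no _ with removeOne x M
...   | just M' = Y ∷ scan M' xs ys
...   | nothing = B ∷ scan M xs ys

feedback : ∀ {k n} → Code k n → Code k n → Vec Colour n
feedback x y = scan (nonGreen x y) x y

-- history of play: list of (guess, feedback) in chronological order
History : ℕ → ℕ → Set
History k n = List (Code k n × Vec Colour n)

Strategy : ℕ → ℕ → Set
Strategy k n = History k n → Code k n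

run : ∀ {k n} → Strategy k n → Code k n → ℕ → History k n
run s y zero = []
run s y (suc m) = let h = run s y m ; g = s h in h ++ [ (g , feedback g y) ]

SolvesWithin : ∀ {k n} → Strategy k n → ℕ → Set
SolvesWithin {k} {n} s m = (y : Code k n) → Any (λ p → proj₁ p ≡ y) (run s y m)

Solvable : ℕ → ℕ → ℕ → Set
Solvable k n m = ∃ λ (s : Strategy k n) → SolvesWithin s m

IsF : ℕ → ℕ → ℕ → Set
IsF k n m = Solvable k n m × ((m' : ℕ) → m' < m → ¬ Solvable k n m')

{-# OPTIONS --safe #-}
-- Upper bound: the first c guesses contain every colour exactly once and so reveal which colours
-- occur in the answer; afterwards any code consistent with the history is guessed. If a consistent
-- guess is wrong at i, then so were all earlier ones. When some colour is repeated in the answer,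
-- their entries at i are distinct wrong colours out of at most n - 1. Otherwise the colour wanted
-- at i has been tried at distinct wrong positions, one of them already in the first c guesses.
-- Either way n - 1 consistent guesses suffice.
--
-- Lower bound: an adversary answers the first c - 1 guesses all black and is left with n unused
-- colours. From then on the answer is a permutation of these. The adversary keeps a set A of
-- undecided positions and a list of allowed colours for each, all of them placed inside A by the
-- current candidate; a guess costs each list at most one colour, so after n - 1 guesses A is not
-- empty and no guess was right there. To avoid greens on A, a green at p is moved away along a
-- cycle of allowed colours; if there is none, the positions that p can reach, without p itself,
-- serve as the new A.
module Submission where

open import Defs
open import Data.Nat using (ℕ; zero; suc; _≤_; _<_; _*_; _+_; _∸_; z≤n; s≤s; _<?_)
open import Data.Nat.Properties
  using (≤-refl; ≤-trans; ≤-reflexive; ≤-pred; <⇒≤; <⇒≱; <-irrefl; <-≤-trans; n<1+n;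
         m≤m+n; m≤n+m; m<1+n⇒m<n∨m≡n; m≤n⇒m<n∨m≡n; m≤n⇒∃[o]m+o≡n;
         +-suc; +-comm; +-identityʳ; +-monoʳ-<; +-monoʳ-≤)
open import Data.Fin as Fin using (Fin; zero; suc; _≟_; toℕ; fromℕ<; combine; punchOut)
open import Data.Fin.Properties
  using (any?; suc-injective; toℕ<n; toℕ-injective; toℕ-fromℕ<; injective⇒≤;
         pigeonhole; combine-surjective; combine-injectiveʳ; punchOut-injective)
open import Data.Fin.Permutation as Perm using (Permutation′; _⟨$⟩ʳ_; _⟨$⟩ˡ_; _∘ₚ_; inverseʳ; inverseˡ)
import Data.Fin.Permutation.Components as PC
open import Data.Vec using (Vec; []; _∷_; lookup; replicate; tabulate; toList)
open import Data.Vec.Properties using (lookup∘tabulate; tabulate∘lookup; tabulate-cong; length-toList; ≡-dec)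
import Data.Vec.Membership.Propositional.Properties as VecMembership
open import Data.List as List using (List; []; _∷_; [_]; _++_; length; filter)
open import Data.List.Properties using (filter-all; length-++; length-tabulate)
open import Data.List.Membership.Propositional using (_∈_; _∉_; find; lose)
open import Data.List.Membership.Propositional.Properties
  using (∈-lookup; ∈-filter⁺; ∈-filter⁻; ∈-tabulate⁺; ∈-tabulate⁻; ∈-++⁺ˡ; ∈-++⁺ʳ)
open import Data.List.Membership.Propositional.Properties.WithK using (unique∧set⇒bag)
open import Data.List.Membership.Setoid.Properties using (index-injective)
import Data.List.Membership.DecPropositional as DecMembership
open import Data.List.Relation.Unary.Any using (Any; here; there)
import Data.List.Relation.Unary.Any.Properties as Any
open import Data.List.Relation.Unary.All as All using (All)
import Data.List.Relation.Unary.All.Properties as All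
open import Data.List.Relation.Unary.AllPairs using () renaming ([] to []ᵖ; _∷_ to _∷ᵖ_)
open import Data.List.Relation.Unary.Unique.Propositional using (Unique)
open import Data.List.Relation.Unary.Unique.Propositional.Properties using (filter⁺; tabulate⁺)
open import Data.List.Relation.Binary.BagAndSetEquality using (∼bag⇒↭)
open import Data.List.Relation.Binary.Permutation.Propositional using (_↭_; ↭-refl; ↭-sym; ↭-trans; prep; swap)
open import Data.List.Relation.Binary.Permutation.Propositional.Properties using (∈-resp-↭; drop-∷)
open import Data.Maybe using (just; nothing)
open import Data.Product using (_×_; _,_; proj₁; proj₂; ∃; ∃-syntax)
open import Data.Sum using (_⊎_; inj₁; inj₂)
open import Data.Unit using (⊤; tt)
open import Function using (_∘_; id; _⇔_; mk⇔; Equivalence)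
open import Function.Definitions using (Injective)
open import Relation.Nullary using (¬_; Dec; yes; no; contradiction; ¬?; _×-dec_; map′)
open import Relation.Nullary.Decidable using (decidable-stable)
open import Relation.Unary using (Decidable)
open import Relation.Binary.PropositionalEquality using (_≡_; _≢_; refl; sym; trans; cong; cong₂; subst; setoid)

-- Feedback

removeOne-just : ∀ {k} (a : Fin k) M {M'} → removeOne a M ≡ just M' → M ↭ a ∷ M'
removeOne-just a (b ∷ M) eq with a ≟ b
removeOne-just a (.a ∷ M) refl | yes refl = ↭-refl
... | no _ with removeOne a M in eq'
removeOne-just a (b ∷ M) refl | no _ | just M' =
  ↭-trans (prep b (removeOne-just a M eq')) (swap b a ↭-refl)

removeOne-nothing : ∀ {k} (a : Fin k) M → removeOne a M ≡ nothing → a ∉ M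
removeOne-nothing a (b ∷ M) eq a∈ with a ≟ b
removeOne-nothing a (b ∷ M) () a∈ | yes _
removeOne-nothing a (b ∷ M) eq a∈ | no a≢b with removeOne a M in eq'
removeOne-nothing a (b ∷ M) eq (here a≡b) | no a≢b | nothing = a≢b a≡b
removeOne-nothing a (b ∷ M) eq (there a∈) | no a≢b | nothing = removeOne-nothing a M eq' a∈

∈-removeOne : ∀ {k} {a b : Fin k} {M M'} → a ≢ b → M ↭ b ∷ M' → a ∈ M → a ∈ M'
∈-removeOne a≢b M↭ a∈M with ∈-resp-↭ M↭ a∈M
... | here a≡b = contradiction a≡b a≢b
... | there a∈M' = a∈M'

scan-cong : ∀ {k n} {M M' : List (Fin k)} (x y w : Code k n) → M ↭ M' →
  (∀ i → lookup x i ≡ lookup y i ⇔ lookup x i ≡ lookup w i) → scan M x y ≡ scan M' x w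
scan-cong [] [] [] M↭M' greens = refl
scan-cong {M = M} {M'} (a ∷ x) (b ∷ y) (c ∷ w) M↭M' greens with a ≟ b | a ≟ c
... | yes _ | yes _ = cong (G ∷_) (scan-cong x y w M↭M' (greens ∘ suc))
... | yes p | no q = contradiction (Equivalence.to (greens zero) p) q
... | no p | yes q = contradiction (Equivalence.from (greens zero) q) p
... | no _ | no _ with removeOne a M in eq | removeOne a M' in eq'
... | just N | just N' = cong (Y ∷_) (scan-cong x y w
        (drop-∷ (↭-trans (↭-sym (removeOne-just a M eq)) (↭-trans M↭M' (removeOne-just a M' eq'))))
        (greens ∘ suc))
... | just N | nothing = contradiction
        (∈-resp-↭ M↭M' (∈-resp-↭ (↭-sym (removeOne-just a M eq)) (here refl))) (removeOne-nothing a M' eq')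
... | nothing | just N' = contradiction
        (∈-resp-↭ (↭-sym M↭M') (∈-resp-↭ (↭-sym (removeOne-just a M' eq')) (here refl))) (removeOne-nothing a M eq)
... | nothing | nothing = cong (B ∷_) (scan-cong x y w M↭M' (greens ∘ suc))

∈-nonGreen⁻ : ∀ {k n} {a : Fin k} (x y : Code k n) → a ∈ nonGreen x y → ∃[ i ] (lookup y i ≡ a × lookup x i ≢ a)
∈-nonGreen⁻ [] [] ()
∈-nonGreen⁻ (b ∷ x) (c ∷ y) a∈ with b ≟ c
∈-nonGreen⁻ (b ∷ x) (c ∷ y) (here refl) | no b≢c = zero , refl , b≢c
∈-nonGreen⁻ (b ∷ x) (c ∷ y) (there a∈) | no b≢c with i , p ← ∈-nonGreen⁻ x y a∈ = suc i , p
∈-nonGreen⁻ (b ∷ x) (c ∷ y) a∈ | yes _ with i , p ← ∈-nonGreen⁻ x y a∈ = suc i , p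

∈-nonGreen⁺ : ∀ {k n} (x y : Code k n) i → lookup x i ≢ lookup y i → lookup y i ∈ nonGreen x y
∈-nonGreen⁺ (b ∷ x) (c ∷ y) i x≢y with b ≟ c
∈-nonGreen⁺ (b ∷ x) (c ∷ y) zero x≢y | yes b≡c = contradiction b≡c x≢y
∈-nonGreen⁺ (b ∷ x) (c ∷ y) (suc i) x≢y | yes _ = ∈-nonGreen⁺ x y i x≢y
∈-nonGreen⁺ (b ∷ x) (c ∷ y) zero x≢y | no _ = here refl
∈-nonGreen⁺ (b ∷ x) (c ∷ y) (suc i) x≢y | no _ = there (∈-nonGreen⁺ x y i x≢y)

nonGreen-unique : ∀ {k n} (x y : Code k n) → Injective _≡_ _≡_ (lookup y) → Unique (nonGreen x y)
nonGreen-unique [] [] inj = []ᵖ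
nonGreen-unique (a ∷ x) (b ∷ y) inj with a ≟ b
... | yes _ = nonGreen-unique x y (suc-injective ∘ inj)
... | no _ = All.¬Any⇒All¬ _ b∉ ∷ᵖ nonGreen-unique x y (suc-injective ∘ inj)
  where
  b∉ : b ∉ nonGreen x y
  b∉ b∈ with i , yi≡b , _ ← ∈-nonGreen⁻ x y b∈ with () ← inj {suc i} {zero} yi≡b

nonGreen-⊆ : ∀ {k n} {a : Fin k} (x y w : Code k n) → Injective _≡_ _≡_ (lookup y) →
  (∀ i → ∃[ j ] lookup y i ≡ lookup w j) → (∀ i → lookup x i ≡ lookup w i → lookup x i ≡ lookup y i) → a ∈ nonGreen x y → a ∈ nonGreen x w
nonGreen-⊆ x y w inj-y y⊆w greens a∈
  with i , refl , xi≢a ← ∈-nonGreen⁻ x y a∈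
  with j , yi≡wj ← y⊆w i =
  subst (_∈ nonGreen x w) (sym yi≡wj) (∈-nonGreen⁺ x w j λ xj≡wj →
    xi≢a (subst (λ p → lookup x p ≡ lookup y p)
                (inj-y (trans (sym (greens j xj≡wj)) (trans xj≡wj (sym yi≡wj))))
                (greens j xj≡wj)))

feedback-cong : ∀ {k n} (x y w : Code k n) → Injective _≡_ _≡_ (lookup y) → Injective _≡_ _≡_ (lookup w) →
  (∀ i → ∃[ j ] lookup y i ≡ lookup w j) → (∀ i → ∃[ j ] lookup w i ≡ lookup y j) →
  (∀ i → lookup x i ≡ lookup y i ⇔ lookup x i ≡ lookup w i) → feedback x y ≡ feedback x w
feedback-cong x y w inj-y inj-w y⊆w w⊆y greens = scan-cong x y w
  (∼bag⇒↭ (unique∧set⇒bag (nonGreen-unique x y inj-y) (nonGreen-unique x w inj-w)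
    (mk⇔ (nonGreen-⊆ x y w inj-y y⊆w (Equivalence.from ∘ greens))
         (nonGreen-⊆ x w y inj-w w⊆y (Equivalence.to ∘ greens))))) greens

scan-black : ∀ {k n} {M : List (Fin k)} (x y : Code k n) →
  (∀ i → lookup x i ≢ lookup y i) → (∀ i → lookup x i ∉ M) → scan M x y ≡ replicate n B
scan-black [] [] x≢y x∉M = refl
scan-black {M = M} (a ∷ x) (b ∷ y) x≢y x∉M with a ≟ b
... | yes a≡b = contradiction a≡b (x≢y zero)
... | no _ with removeOne a M in eq
...   | just N = contradiction (∈-resp-↭ (↭-sym (removeOne-just a M eq)) (here refl)) (x∉M zero)
...   | nothing = cong (B ∷_) (scan-black x y (x≢y ∘ suc) (x∉M ∘ suc))

feedback-black : ∀ {k n} (x y : Code k n) → (∀ i j → lookup x i ≢ lookup y j) → feedback x y ≡ replicate n B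
feedback-black x y x≢y = scan-black x y (λ i → x≢y i i)
  λ i xi∈ → let j , yj≡xi , _ = ∈-nonGreen⁻ x y xi∈ in x≢y i j (sym yj≡xi)

scan-green⁺ : ∀ {k n} (M : List (Fin k)) (x y : Code k n) i → lookup x i ≡ lookup y i → lookup (scan M x y) i ≡ G
scan-green⁺ M (a ∷ x) (b ∷ y) i x≡y with a ≟ b
scan-green⁺ M (a ∷ x) (b ∷ y) zero x≡y | yes _ = refl
scan-green⁺ M (a ∷ x) (b ∷ y) (suc i) x≡y | yes _ = scan-green⁺ M x y i x≡y
... | no a≢b with removeOne a M
scan-green⁺ M (a ∷ x) (b ∷ y) zero x≡y | no a≢b | _ = contradiction x≡y a≢b
scan-green⁺ M (a ∷ x) (b ∷ y) (suc i) x≡y | no a≢b | just N = scan-green⁺ N x y i x≡y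
scan-green⁺ M (a ∷ x) (b ∷ y) (suc i) x≡y | no a≢b | nothing = scan-green⁺ M x y i x≡y

scan-green⁻ : ∀ {k n} (M : List (Fin k)) (x y : Code k n) i → lookup (scan M x y) i ≡ G → lookup x i ≡ lookup y i
scan-green⁻ M (a ∷ x) (b ∷ y) i π≡G with a ≟ b
scan-green⁻ M (a ∷ x) (b ∷ y) zero π≡G | yes a≡b = a≡b
scan-green⁻ M (a ∷ x) (b ∷ y) (suc i) π≡G | yes _ = scan-green⁻ M x y i π≡G
... | no a≢b with removeOne a M
scan-green⁻ M (a ∷ x) (b ∷ y) zero () | no a≢b | just _
scan-green⁻ M (a ∷ x) (b ∷ y) zero () | no a≢b | nothing
scan-green⁻ M (a ∷ x) (b ∷ y) (suc i) π≡G | no a≢b | just N = scan-green⁻ N x y i π≡G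
scan-green⁻ M (a ∷ x) (b ∷ y) (suc i) π≡G | no a≢b | nothing = scan-green⁻ M x y i π≡G

scan-black⁻ : ∀ {k n} (M : List (Fin k)) (x y : Code k n) i → Injective _≡_ _≡_ (lookup x) →
  lookup (scan M x y) i ≡ B → lookup x i ∉ M
scan-black⁻ M (a ∷ x) (b ∷ y) i inj π≡B with a ≟ b
scan-black⁻ M (a ∷ x) (b ∷ y) zero inj () | yes _
scan-black⁻ M (a ∷ x) (b ∷ y) (suc i) inj π≡B | yes _ = scan-black⁻ M x y i (suc-injective ∘ inj) π≡B
... | no _ with removeOne a M in eq
scan-black⁻ M (a ∷ x) (b ∷ y) zero inj () | no _ | just _
scan-black⁻ M (a ∷ x) (b ∷ y) zero inj π≡B | no _ | nothing = removeOne-nothing a M eq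
scan-black⁻ M (a ∷ x) (b ∷ y) (suc i) inj π≡B | no _ | nothing = scan-black⁻ M x y i (suc-injective ∘ inj) π≡B
scan-black⁻ M (a ∷ x) (b ∷ y) (suc i) inj π≡B | no _ | just N = λ xi∈M →
  scan-black⁻ N x y i (suc-injective ∘ inj) π≡B
    (∈-removeOne (λ xi≡a → contradiction (inj {suc i} {zero} xi≡a) λ ()) (removeOne-just a M eq) xi∈M)

scan-yellow⁻ : ∀ {k n} (M : List (Fin k)) (x y : Code k n) i → lookup (scan M x y) i ≡ Y → lookup x i ∈ M
scan-yellow⁻ M (a ∷ x) (b ∷ y) i π≡Y with a ≟ b
scan-yellow⁻ M (a ∷ x) (b ∷ y) zero () | yes _
scan-yellow⁻ M (a ∷ x) (b ∷ y) (suc i) π≡Y | yes _ = scan-yellow⁻ M x y i π≡Y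
... | no _ with removeOne a M in eq
scan-yellow⁻ M (a ∷ x) (b ∷ y) zero π≡Y | no _ | just _ = ∈-resp-↭ (↭-sym (removeOne-just a M eq)) (here refl)
scan-yellow⁻ M (a ∷ x) (b ∷ y) zero () | no _ | nothing
scan-yellow⁻ M (a ∷ x) (b ∷ y) (suc i) π≡Y | no _ | nothing = scan-yellow⁻ M x y i π≡Y
scan-yellow⁻ M (a ∷ x) (b ∷ y) (suc i) π≡Y | no _ | just N =
  ∈-resp-↭ (↭-sym (removeOne-just a M eq)) (there (scan-yellow⁻ N x y i π≡Y))

feedback-green : ∀ {k n} (x y w : Code k n) i → feedback x y ≡ feedback x w →
  lookup x i ≡ lookup y i → lookup x i ≡ lookup w i
feedback-green x y w i same x≡y = scan-green⁻ (nonGreen x w) x w i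
  (trans (cong (λ π → lookup π i) (sym same)) (scan-green⁺ (nonGreen x y) x y i x≡y))

-- A guess without repeated colours tells exactly which of its colours occur in the answer.
feedback-colours : ∀ {k n} (x y w : Code k n) i j → Injective _≡_ _≡_ (lookup x) → feedback x y ≡ feedback x w →
  lookup x i ≡ lookup y j → ∃[ l ] lookup x i ≡ lookup w l
feedback-colours x y w i j inj same x≡y with lookup (feedback x w) i in eq
... | G = i , scan-green⁻ (nonGreen x w) x w i eq
... | Y with l , w≡x , _ ← ∈-nonGreen⁻ x w (scan-yellow⁻ (nonGreen x w) x w i eq) = l , sym w≡x
... | B = contradiction (subst (_∈ nonGreen x y) (sym x≡y) (∈-nonGreen⁺ x y j xj≢yj))
                        (scan-black⁻ (nonGreen x y) x y i inj xi-black)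
  where
  xi-black : lookup (feedback x y) i ≡ B
  xi-black = trans (cong (λ π → lookup π i) same) eq
  xj≢yj : lookup x j ≢ lookup y j
  xj≢yj xj≡yj with refl ← inj (trans xj≡yj (sym x≡y))
    with () ← trans (sym xi-black) (scan-green⁺ (nonGreen x y) x y i x≡y)

-- Avoiding greens by rearranging the answer

lookup-injective : ∀ {X : Set} {xs : List X} → Unique xs → Injective _≡_ _≡_ (List.lookup xs)
lookup-injective (x∉ ∷ᵖ u) {zero} {zero} eq = refl
lookup-injective (x∉ ∷ᵖ u) {zero} {suc j} eq = contradiction eq (All.lookup x∉ (∈-lookup j))
lookup-injective (x∉ ∷ᵖ u) {suc i} {zero} eq = contradiction (sym eq) (All.lookup x∉ (∈-lookup i))
lookup-injective (x∉ ∷ᵖ u) {suc i} {suc j} eq = cong suc (lookup-injective u eq)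

unique-length : ∀ {n} {xs : List (Fin n)} → Unique xs → length xs ≤ n
unique-length u = injective⇒≤ (lookup-injective u)

transpose-source : ∀ {n} (i j : Fin n) → PC.transpose i j i ≡ j
transpose-source i j with i ≟ i
... | yes _ = refl
... | no i≢i = contradiction refl i≢i

transpose-target : ∀ {n} (i j : Fin n) → PC.transpose i j j ≡ i
transpose-target i j with j ≟ i
... | yes j≡i = j≡i
... | no _ with j ≟ j
...   | yes _ = refl
...   | no j≢j = contradiction refl j≢j

transpose-other : ∀ {n} (i j : Fin n) {l} → l ≢ i → l ≢ j → PC.transpose i j l ≡ l
transpose-other i j {l} l≢i l≢j with l ≟ i
... | yes l≡i = contradiction l≡i l≢i
... | no _ with l ≟ j
...   | yes l≡j = contradiction l≡j l≢j
...   | no _ = refl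

record Rearranges {k n} (A : Fin n → Set) (L : Fin n → List (Fin k)) (y w : Fin n → Fin k) : Set where
  field
    π       : Permutation′ n
    moved   : ∀ i → w i ≡ y (π ⟨$⟩ʳ i)
    fixed   : ∀ i → ¬ A i → w i ≡ y i
    allowed : ∀ i → A i → w i ∈ L i

open Rearranges

rearranges-refl : ∀ {k n} {A : Fin n → Set} {L : Fin n → List (Fin k)} {y} →
  (∀ i → A i → y i ∈ L i) → Rearranges A L y y
rearranges-refl y∈L = record { π = Perm.id ; moved = λ _ → refl ; fixed = λ _ _ → refl ; allowed = y∈L }

rearranges-trans : ∀ {k n} {A A′ : Fin n → Set} {L L′ : Fin n → List (Fin k)} {y w v} → Decidable A′ →
  (∀ {i} → A′ i → A i) → (∀ {i a} → a ∈ L′ i → a ∈ L i) →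
  Rearranges A L y w → Rearranges A′ L′ w v → Rearranges A L y v
rearranges-trans A′? A′⊆A L′⊆L r s = record
  { π       = s .π ∘ₚ r .π
  ; moved   = λ i → trans (s .moved i) (r .moved _)
  ; fixed   = λ i ¬Ai → trans (s .fixed i (¬Ai ∘ A′⊆A)) (r .fixed i ¬Ai)
  ; allowed = λ i Ai → case-allowed i Ai (A′? i)
  }
  where
  case-allowed : ∀ i → _ → Dec _ → _ ∈ _
  case-allowed i Ai (yes A′i) = L′⊆L (s .allowed i A′i)
  case-allowed i Ai (no ¬A′i) = subst (_∈ _) (sym (s .fixed i ¬A′i)) (r .allowed i Ai)

rearranges-injective : ∀ {k n} {A : Fin n → Set} {L : Fin n → List (Fin k)} {y w} →
  Injective _≡_ _≡_ y → Rearranges A L y w → Injective _≡_ _≡_ w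
rearranges-injective inj r {i} {j} wi≡wj =
  trans (sym (inverseˡ (r .π)))
    (trans (cong (r .π ⟨$⟩ˡ_) (inj (trans (sym (r .moved i)) (trans wi≡wj (r .moved j))))) (inverseˡ (r .π)))

Closed : ∀ {k n} → (Fin n → Set) → (Fin n → List (Fin k)) → (x y : Fin n → Fin k) → Set
Closed A L x y = ∀ i → A i → ∀ {a} → a ∈ L i → a ≢ x i → ∃[ j ] (A j × y j ≡ a)

closed-rearranges : ∀ {k n} {A : Fin n → Set} {L : Fin n → List (Fin k)} {x y w} → Decidable A →
  Injective _≡_ _≡_ y → Rearranges A L y w → Closed A L x y → Closed A L x w
closed-rearranges {A = A} {y = y} {w} A? inj r closed i Ai a∈L a≢x
  with j , Aj , refl ← closed i Ai a∈L a≢x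
  with A? (r .π ⟨$⟩ˡ j)
... | yes Aj′ = r .π ⟨$⟩ˡ j , Aj′ , trans (r .moved _) (cong y (inverseʳ (r .π)))
... | no ¬Aj′ = contradiction (subst A (sym j′≡j) Aj) ¬Aj′
  where
  j′≡j : r .π ⟨$⟩ˡ j ≡ j
  j′≡j = inj (trans (sym (r .fixed _ ¬Aj′)) (trans (r .moved _) (cong y (inverseʳ (r .π)))))

-- passed arises from y by passing the colour y p along a path from p to j inside S.
record Passes {k n} (L : Fin n → List (Fin k)) (x y : Fin n → Fin k) (p : Fin n)
              (S : List (Fin n)) (j : Fin n) : Set where
  field
    passed  : Fin n → Fin k
    ρ       : Permutation′ n
    moved   : ∀ i → passed i ≡ y (ρ ⟨$⟩ʳ i)
    holder  : passed j ≡ y p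
    outside : ∀ i → i ∉ S → passed i ≡ y i
    settled : ∀ i → i ≢ j → (passed i ≡ y i × i ≢ p) ⊎ (passed i ∈ L i × passed i ≢ x i)

open Passes using (passed; ρ; holder; outside; settled)

passes-refl : ∀ {k n} {L : Fin n → List (Fin k)} {x y p S} → Passes L x y p S p
passes-refl {y = y} = record
  { passed = y ; ρ = Perm.id ; moved = λ _ → refl ; holder = refl
  ; outside = λ _ _ → refl ; settled = λ _ i≢p → inj₁ (refl , i≢p) }

passes-weaken : ∀ {k n} {L : Fin n → List (Fin k)} {x y p S q j} → Passes L x y p S j → Passes L x y p (q ∷ S) j
passes-weaken P = record
  { passed = P .passed ; ρ = P .ρ ; moved = P .Passes.moved ; holder = P .holder
  ; outside = λ i i∉ → P .outside i (i∉ ∘ there) ; settled = P .settled }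

passes-step : ∀ {k n} {L : Fin n → List (Fin k)} {x y p S j q} → Passes L x y p S j → j ∈ S → q ∉ S →
  y q ∈ L j → y q ≢ x j → Passes L x y p (q ∷ S) q
passes-step {k} {n} {L} {x} {y} {p} {S} {j} {q} P j∈S q∉S yq∈L yq≢x = record
  { passed = w′
  ; ρ = Perm.transpose j q ∘ₚ P .ρ
  ; moved = λ i → P .Passes.moved _
  ; holder = trans (cong (P .passed) (transpose-target j q)) (P .holder)
  ; outside = λ i i∉ → trans (unmoved i (λ { refl → i∉ (there j∈S) }) (i∉ ∘ here)) (P .outside i (i∉ ∘ there))
  ; settled = settled′
  }
  where
  w′ : Fin n → Fin k
  w′ i = P .passed (PC.transpose j q i)
  unmoved : ∀ i → i ≢ j → i ≢ q → w′ i ≡ P .passed i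
  unmoved i i≢j i≢q = cong (P .passed) (transpose-other j q i≢j i≢q)
  w′j≡yq : w′ j ≡ y q
  w′j≡yq = trans (cong (P .passed) (transpose-source j q)) (P .outside q q∉S)
  settled′ : ∀ i → i ≢ q → (w′ i ≡ y i × i ≢ p) ⊎ (w′ i ∈ L i × w′ i ≢ x i)
  settled′ i i≢q = settle (i ≟ j)
    where
    settle : Dec (i ≡ j) → (w′ i ≡ y i × i ≢ p) ⊎ (w′ i ∈ L i × w′ i ≢ x i)
    settle (yes refl) = inj₂ (subst (λ a → a ∈ L i × a ≢ x i) (sym w′j≡yq) (yq∈L , yq≢x))
    settle (no i≢j) =
      subst (λ a → (a ≡ y i × i ≢ p) ⊎ (a ∈ L i × a ≢ x i)) (sym (unmoved i i≢j i≢q)) (P .settled i i≢j)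

record Ungreened {k n} (A : Fin n → Set) (L : Fin n → List (Fin k)) (x y : Fin n → Fin k) (p : Fin n) : Set where
  field
    w          : Fin n → Fin k
    rearranges : Rearranges A L y w
    not-green  : w p ≢ x p
    no-new     : ∀ i → w i ≡ x i → y i ≡ x i

passes-close : ∀ {k n} {A : Fin n → Set} {L : Fin n → List (Fin k)} {x y p S j} → Passes L x y p S j →
  (∀ {i} → i ∈ S → A i) → (∀ i → A i → y i ∈ L i) → y p ∈ L j → y p ≢ x j → Ungreened A L x y p
passes-close {A = A} {L} {x} {y} {p} {S} {j} P S⊆A y∈L yp∈L yp≢x = record
  { w = P .passed
  ; rearranges = record
      { π = P .ρ ; moved = P .Passes.moved ; fixed = λ i ¬Ai → P .outside i (¬Ai ∘ S⊆A) ; allowed = allowed′ }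
  ; not-green = not-green′
  ; no-new = no-new′
  }
  where
  allowed′ : ∀ i → A i → P .passed i ∈ L i
  allowed′ i Ai with i ≟ j
  ... | yes refl = subst (_∈ L i) (sym (P .holder)) yp∈L
  ... | no i≢j with P .settled i i≢j
  ...   | inj₁ (w≡y , _) = subst (_∈ L i) (sym w≡y) (y∈L i Ai)
  ...   | inj₂ (w∈L , _) = w∈L
  wj≢xj : P .passed j ≢ x j
  wj≢xj wj≡xj = yp≢x (trans (sym (P .holder)) wj≡xj)
  not-green′ : P .passed p ≢ x p
  not-green′ with p ≟ j
  ... | yes refl = wj≢xj
  ... | no p≢j with P .settled p p≢j
  ...   | inj₁ (_ , p≢p) = contradiction refl p≢p
  ...   | inj₂ (_ , wp≢xp) = wp≢xp
  no-new′ : ∀ i → P .passed i ≡ x i → y i ≡ x i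
  no-new′ i w≡x with i ≟ j
  ... | yes refl = contradiction w≡x wj≢xj
  ... | no i≢j with P .settled i i≢j
  ...   | inj₁ (w≡y , _) = trans (sym w≡y) w≡x
  ...   | inj₂ (_ , w≢x) = contradiction w≡x w≢x

record Shrunk {k n} (A : Fin n → Set) (L : Fin n → List (Fin k)) (x y : Fin n → Fin k) (p : Fin n) : Set₁ where
  field
    A′        : Fin n → Set
    A′?       : Decidable A′
    A′⊆A      : ∀ {i} → A′ i → A i
    inhabited : ∃ A′
    closed    : Closed A′ L x y
    avoids    : ¬ A′ p

_∈?_ : ∀ {n} (a : Fin n) (xs : List (Fin n)) → Dec (a ∈ xs)
_∈?_ = DecMembership._∈?_ _≟_

-- S collects the positions to which the colour y p can be passed.
explore : ∀ {k n} {A : Fin n → Set} {L : Fin n → List (Fin k)} {x y p} →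
  Injective _≡_ _≡_ y → Closed A L x y → (∀ i → A i → y i ∈ L i) → (∃[ a ] (a ∈ L p × a ≢ x p)) →
  (fuel : ℕ) (S : List (Fin n)) → n < length S + fuel → Unique S → p ∈ S →
  (∀ {j} → j ∈ S → A j) → (∀ {j} → j ∈ S → Passes L x y p S j) →
  Ungreened A L x y p ⊎ Shrunk A L x y p
explore {n = n} {A} {L} {x} {y} {p} inj closed y∈L choice fuel S big unique p∈S S⊆A passes
  with any? (λ j → (j ∈? S) ×-dec (y p ∈? L j) ×-dec ¬? (y p ≟ x j))
     | any? (λ j → any? λ q → (j ∈? S) ×-dec ¬? (q ∈? S) ×-dec (y q ∈? L j) ×-dec ¬? (y q ≟ x j))
... | yes (j , j∈S , yp∈L , yp≢x) | _ = inj₁ (passes-close (passes j∈S) S⊆A y∈L yp∈L yp≢x)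
... | no no-return | no no-exit = inj₂ record
  { A′ = λ i → i ∈ S × i ≢ p
  ; A′? = λ i → (i ∈? S) ×-dec ¬? (i ≟ p)
  ; A′⊆A = S⊆A ∘ proj₁
  ; inhabited = let a , a∈L , a≢x = choice ; j , j∈ , _ = stays p∈S a∈L a≢x in j , j∈
  ; closed = λ i (i∈S , _) → stays i∈S
  ; avoids = λ (_ , p≢p) → p≢p refl
  }
  where
  stays : ∀ {i a} → i ∈ S → a ∈ L i → a ≢ x i → ∃[ j ] ((j ∈ S × j ≢ p) × y j ≡ a)
  stays {i} i∈S a∈L a≢x with j , Aj , refl ← closed i (S⊆A i∈S) a∈L a≢x with j ∈? S
  ... | no j∉S = contradiction (i , j , i∈S , j∉S , a∈L , a≢x) no-exit
  ... | yes j∈S = j , (j∈S , λ { refl → no-return (i , i∈S , a∈L , a≢x) }) , refl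
explore {n = n} inj closed y∈L choice zero S big unique p∈S S⊆A passes
  | no _ | yes _ =
  contradiction (<-≤-trans big (subst (_≤ n) (sym (+-identityʳ _)) (unique-length unique))) (<-irrefl refl)
explore {n = n} {A} {L} {x} {y} {p} inj closed y∈L choice (suc fuel) S big unique p∈S S⊆A passes
  | no _ | yes (j , q , j∈S , q∉S , yq∈L , yq≢x) =
  explore inj closed y∈L choice fuel (q ∷ S) (subst (n <_) (+-suc _ _) big)
    (All.¬Any⇒All¬ S q∉S ∷ᵖ unique) (there p∈S) S′⊆A passes′
  where
  S′⊆A : ∀ {i} → i ∈ q ∷ S → A i
  S′⊆A (here refl) with i , Ai , yi≡yq ← closed j (S⊆A j∈S) yq∈L yq≢x = subst A (inj yi≡yq) Ai
  S′⊆A (there i∈S) = S⊆A i∈S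
  passes′ : ∀ {i} → i ∈ q ∷ S → Passes L x y p (q ∷ S) i
  passes′ (here refl) = passes-step (passes j∈S) j∈S q∉S yq∈L yq≢x
  passes′ (there i∈S) = passes-weaken (passes i∈S)

record Dodge {k n} (A : Fin n → Set) (L : Fin n → List (Fin k)) (x y : Fin n → Fin k) (m : ℕ) : Set₁ where
  field
    A′         : Fin n → Set
    A′?        : Decidable A′
    A′⊆A       : ∀ {i} → A′ i → A i
    inhabited  : ∃ A′
    w          : Fin n → Fin k
    rearranges : Rearranges A L y w
    closed     : Closed A′ L x w
    dodges     : ∀ i → toℕ i < m → A′ i → w i ≢ x i

dodge : ∀ {k n} {A : Fin n → Set} {L : Fin n → List (Fin k)} {x y} → Decidable A → ∃ A → Injective _≡_ _≡_ y →
  (∀ i → A i → y i ∈ L i) → Closed A L x y → (∀ i → A i → ∃[ a ] (a ∈ L i × a ≢ x i)) →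
  ∀ m → m ≤ n → Dodge A L x y m
dodge {A = A} {y = y} A? inhabited inj y∈L closed choice zero _ = record
  { A′ = A ; A′? = A? ; A′⊆A = id ; inhabited = inhabited ; w = y ; rearranges = rearranges-refl y∈L
  ; closed = closed ; dodges = λ _ () }
dodge {n = n} {A} {L} {x} {y} A? inhabited inj y∈L closed choice (suc m) m<n = result
  where
  open Dodge (dodge A? inhabited inj y∈L closed choice m (<⇒≤ m<n)) renaming
    (inhabited to inhabited′; w to w₁; rearranges to rearranges₁; closed to closed₁; dodges to dodges₁)
  p : Fin n
  p = fromℕ< m<n
  w₁∈L : ∀ i → A′ i → w₁ i ∈ L i
  w₁∈L i A′i = rearranges₁ .allowed i (A′⊆A A′i)
  extend : ∀ {P : Fin n → Set} → (∀ i → toℕ i < m → P i) → P p → ∀ i → toℕ i < suc m → P i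
  extend {P} below at i i<1+m with m<1+n⇒m<n∨m≡n i<1+m
  ... | inj₁ i<m = below i i<m
  ... | inj₂ i≡m = subst P (toℕ-injective (trans (toℕ-fromℕ< m<n) (sym i≡m))) at
  result : Dodge A L x y (suc m)
  result with A′? p ×-dec (w₁ p ≟ x p)
  ... | no fine = record
    { A′ = A′ ; A′? = A′? ; A′⊆A = A′⊆A ; inhabited = inhabited′ ; w = w₁
    ; rearranges = rearranges₁ ; closed = closed₁
    ; dodges = extend dodges₁ λ A′p w≡x → fine (A′p , w≡x) }
  ... | yes (A′p , _) with explore (rearranges-injective inj rearranges₁) closed₁ w₁∈L (choice p (A′⊆A A′p))
                             n (p ∷ []) ≤-refl (All.[] ∷ᵖ []ᵖ) (here refl)
                             (λ { (here refl) → A′p }) (λ { (here refl) → passes-refl })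
  ... | inj₁ U = record
    { A′ = A′ ; A′? = A′? ; A′⊆A = A′⊆A ; inhabited = inhabited′ ; w = U.w
    ; rearranges = rearranges-trans A′? A′⊆A id rearranges₁ U.rearranges
    ; closed = closed-rearranges A′? (rearranges-injective inj rearranges₁) U.rearranges closed₁
    ; dodges = extend (λ i i<m A′i w≡x → dodges₁ i i<m A′i (U.no-new i w≡x)) λ _ → U.not-green }
    where module U = Ungreened U
  ... | inj₂ T = record
    { A′ = T.A′ ; A′? = T.A′? ; A′⊆A = A′⊆A ∘ T.A′⊆A ; inhabited = T.inhabited ; w = w₁
    ; rearranges = rearranges₁ ; closed = T.closed
    ; dodges = extend (λ i i<m T′i → dodges₁ i i<m (T.A′⊆A T′i)) λ T′p → contradiction T′p T.avoids }
    where module T = Shrunk T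

-- The adversary

_without_ : ∀ {k} → List (Fin k) → Fin k → List (Fin k)
xs without a = filter (λ b → ¬? (b ≟ a)) xs

length-without : ∀ {k} (a : Fin k) {xs} → Unique xs → length xs ≤ suc (length (xs without a))
length-without a []ᵖ = z≤n
length-without a {b ∷ xs} (b∉ ∷ᵖ u) with b ≟ a
... | yes refl = s≤s (≤-reflexive (cong length (sym
  (filter-all (λ c → ¬? (c ≟ b)) (All.map (λ b≢c c≡b → b≢c (sym c≡b)) b∉)))))
... | no _ = s≤s (length-without a u)

feedback-rearranges : ∀ {k n} {A : Fin n → Set} {L : Fin n → List (Fin k)} {y w : Fin n → Fin k} (x : Code k n) →
  Decidable A → Injective _≡_ _≡_ y → (∀ i → A i → y i ≢ lookup x i) → (∀ i → A i → lookup x i ∉ L i) →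
  Rearranges A L y w → feedback x (tabulate w) ≡ feedback x (tabulate y)
feedback-rearranges {A = A} {y = y} {w} x A? inj y≢x x∉L r = feedback-cong x (tabulate w) (tabulate y)
  (tabulate-injective (rearranges-injective inj r)) (tabulate-injective inj)
  (λ i → r .π ⟨$⟩ʳ i , lookups w y (r .moved i))
  (λ i → r .π ⟨$⟩ˡ i , lookups y w (sym (trans (r .moved _) (cong y (inverseʳ (r .π))))))
  greens
  where
  lookups : ∀ (f g : Fin _ → Fin _) {i j} → f i ≡ g j → lookup (tabulate f) i ≡ lookup (tabulate g) j
  lookups f g {i} {j} fi≡gj = trans (lookup∘tabulate f i) (trans fi≡gj (sym (lookup∘tabulate g j)))
  tabulate-injective : ∀ {f : Fin _ → Fin _} → Injective _≡_ _≡_ f → Injective _≡_ _≡_ (lookup (tabulate f))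
  tabulate-injective {f} f-inj {i} {j} eq =
    f-inj (trans (sym (lookup∘tabulate f i)) (trans eq (lookup∘tabulate f j)))
  greens : ∀ i → lookup x i ≡ lookup (tabulate w) i ⇔ lookup x i ≡ lookup (tabulate y) i
  greens i rewrite lookup∘tabulate w i | lookup∘tabulate y i with A? i
  ... | yes Ai = mk⇔ (λ x≡w → contradiction (subst (_∈ _) (sym x≡w) (r .allowed i Ai)) (x∉L i Ai))
                     (λ x≡y → contradiction (sym x≡y) (y≢x i Ai))
  ... | no ¬Ai = mk⇔ (λ x≡w → trans x≡w (r .fixed i ¬Ai)) (λ x≡y → trans x≡y (sym (r .fixed i ¬Ai)))

-- The adversary's position after t rounds: all answers that permute the colours of y within A,
-- respecting the lists L, have produced the history h, and no guess is compatible with L on A.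
record Adversary {k n} (s : Strategy k n) (t r : ℕ) : Set₁ where
  field
    A          : Fin n → Set
    A?         : Decidable A
    inhabited  : ∃ A
    y          : Fin n → Fin k
    injective  : Injective _≡_ _≡_ y
    L          : Fin n → List (Fin k)
    y∈L        : ∀ i → A i → y i ∈ L i
    L⊆y        : ∀ i → A i → ∀ {a} → a ∈ L i → ∃[ j ] (A j × y j ≡ a)
    unique     : ∀ i → A i → Unique (L i)
    long       : ∀ i → A i → r ≤ length (L i)
    h          : History k n
    consistent : ∀ w → Rearranges A L y w → run s (tabulate w) t ≡ h
    unguessed  : All (λ (g , _) → ∀ i → A i → lookup g i ∉ L i) h

adversary-step : ∀ {k n} {s : Strategy k n} {t r} → Adversary s t (suc (suc r)) → Adversary s (suc t) (suc r)
adversary-step {k} {n} {s} {t} {r} adv = record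
  { A = A′ ; A? = A′? ; inhabited = D.inhabited ; y = w ; injective = rearranges-injective injective rearranges
  ; L = L′
  ; y∈L = λ i A′i → ∈-filter⁺ _ (rearranges .allowed i (A′⊆A A′i)) (dodges i (toℕ<n i) A′i)
  ; L⊆y = λ i A′i a∈L′ → let a∈L , a≢x = ∈-filter⁻ (≢x? i) a∈L′ in closed i A′i a∈L a≢x
  ; unique = λ i A′i → filter⁺ _ (unique i (A′⊆A A′i))
  ; long = λ i A′i → long′ i (A′⊆A A′i)
  ; h = h ++ [ (x , feedback x (tabulate w)) ]
  ; consistent = consistent′
  ; unguessed = All.++⁺ (All.map (λ g∉L i A′i → g∉L i (A′⊆A A′i) ∘ L′⊆L) unguessed)
                         ((λ i _ → x∉L′ i) All.∷ All.[])
  }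
  where
  open Adversary adv
  x : Code k n
  x = s h
  ≢x? : ∀ i (a : Fin k) → Dec (a ≢ lookup x i)
  ≢x? i a = ¬? (a ≟ lookup x i)
  L′ : Fin n → List (Fin k)
  L′ i = L i without lookup x i
  L′⊆L : ∀ {i a} → a ∈ L′ i → a ∈ L i
  L′⊆L = proj₁ ∘ ∈-filter⁻ (≢x? _)
  x∉L′ : ∀ i → lookup x i ∉ L′ i
  x∉L′ i x∈ = proj₂ (∈-filter⁻ (≢x? i) {xs = L i} x∈) refl
  long′ : ∀ i → A i → suc r ≤ length (L′ i)
  long′ i Ai = ≤-pred (≤-trans (long i Ai) (length-without (lookup x i) (unique i Ai)))
  choice : ∀ i → A i → ∃[ a ] (a ∈ L i × a ≢ lookup x i)
  choice i Ai with L i without lookup x i in eq | long′ i Ai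
  ... | a ∷ _ | _ = a , ∈-filter⁻ (≢x? i) (subst (a ∈_) (sym eq) (here refl))
  module D = Dodge (dodge {x = lookup x} A? inhabited injective y∈L (λ i Ai a∈L _ → L⊆y i Ai a∈L) choice n ≤-refl)
  open D using (A′; A′?; A′⊆A; w; rearranges; closed; dodges)
  consistent′ : ∀ v → Rearranges A′ L′ w v → run s (tabulate v) (suc t) ≡ h ++ [ (x , feedback x (tabulate w)) ]
  consistent′ v r′ rewrite consistent v (rearranges-trans A′? A′⊆A L′⊆L rearranges r′) =
    cong (λ π → h ++ [ (x , π) ])
      (feedback-rearranges x A′? (rearranges-injective injective rearranges) (λ i → dodges i (toℕ<n i))
        (λ i _ → x∉L′ i) r′)

adversary-steps : ∀ {k n} {s : Strategy k n} {t} r → Adversary s t (suc r) → Adversary s (r + t) 1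
adversary-steps zero adv = adv
adversary-steps {s = s} {t} (suc r) adv =
  subst (λ u → Adversary s u 1) (+-suc r t) (adversary-steps r (adversary-step adv))

adversary-wins : ∀ {k n} {s : Strategy k n} {t r} → Adversary s t r → ¬ SolvesWithin s t
adversary-wins adv solves =
  let g , g∈h , g≡y = find (subst (Any _) (consistent y (rearranges-refl y∈L)) (solves (tabulate y)))
      i , Ai = inhabited
  in All.lookup unguessed g∈h i Ai
       (subst (_∈ L i) (sym (trans (cong (λ c → lookup c i) g≡y) (lookup∘tabulate y i))) (y∈L i Ai))
  where open Adversary adv

blackHistory : ∀ {k n} → Strategy k n → ℕ → History k n
blackHistory s zero = []
blackHistory {n = n} s (suc t) = let h = blackHistory s t in h ++ [ (s h , replicate n B) ]

usedColours : ∀ {k n} → Strategy k n → ℕ → List (Fin k)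
usedColours s zero = []
usedColours s (suc t) = toList (s (blackHistory s t)) ++ usedColours s t

length-usedColours : ∀ {k n} (s : Strategy k n) t → length (usedColours s t) ≡ t * n
length-usedColours s zero = refl
length-usedColours s (suc t) = trans (length-++ (toList (s (blackHistory s t))))
  (cong₂ _+_ (length-toList (s (blackHistory s t))) (length-usedColours s t))

guesses-used : ∀ {k n} (s : Strategy k n) t →
  All (λ (g , _) → ∀ i → lookup g i ∈ usedColours s t) (blackHistory s t)
guesses-used s zero = All.[]
guesses-used s (suc t) = All.++⁺
  (All.map (λ g⊆ i → ∈-++⁺ʳ (toList (s (blackHistory s t))) (g⊆ i)) (guesses-used s t))
  ((λ i → ∈-++⁺ˡ (VecMembership.∈-toList⁺ (VecMembership.∈-lookup i (s (blackHistory s t))))) All.∷ All.[])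

run-black : ∀ {k n} (s : Strategy k n) t y → (∀ i → lookup y i ∉ usedColours s t) → run s y t ≡ blackHistory s t
run-black s zero y fresh = refl
run-black s (suc t) y fresh rewrite run-black s t y (λ i → fresh i ∘ ∈-++⁺ʳ (toList (s (blackHistory s t)))) =
  cong (λ π → blackHistory s t ++ [ (s (blackHistory s t) , π) ])
    (feedback-black (s (blackHistory s t)) y λ i j xi≡yj →
    fresh j (∈-++⁺ˡ (subst (_∈ toList (s (blackHistory s t))) xi≡yj
      (VecMembership.∈-toList⁺ (VecMembership.∈-lookup i (s (blackHistory s t)))))))

fresh-colour : ∀ {k} (us : List (Fin k)) → length us < k → ∃[ a ] a ∉ us
fresh-colour us short with any? (λ a → ¬? (a ∈? us))
... | yes found = found
... | no none = contradiction (injective⇒≤ (λ {a} {b} → index-injective (setoid _) (∈us a) (∈us b))) (<⇒≱ short)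
  where
  ∈us : ∀ a → a ∈ us
  ∈us a = decidable-stable (a ∈? us) λ a∉ → none (a , a∉)

fresh-colours : ∀ {k} n (us : List (Fin k)) → n + length us ≤ k →
  ∃[ y ] (Injective {A = Fin n} _≡_ _≡_ y × (∀ i → y i ∉ us))
fresh-colours zero us _ = (λ ()) , (λ {}) , λ ()
fresh-colours {k} (suc n) us room
  with a , a∉ ← fresh-colour us (≤-trans (s≤s (m≤n+m (length us) n)) room)
  with y , inj , y∉ ← fresh-colours n (a ∷ us) (subst (_≤ k) (sym (+-suc n (length us))) room) = y′ , inj′ , y′∉
  where
  y′ : Fin (suc n) → Fin _
  y′ zero = a
  y′ (suc i) = y i
  inj′ : Injective _≡_ _≡_ y′
  inj′ {zero} {zero} _ = refl
  inj′ {zero} {suc j} a≡y = contradiction (here (sym a≡y)) (y∉ j)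
  inj′ {suc i} {zero} y≡a = contradiction (here y≡a) (y∉ i)
  inj′ {suc i} {suc j} y≡y = cong suc (inj y≡y)
  y′∉ : ∀ i → y′ i ∉ us
  y′∉ zero = a∉
  y′∉ (suc i) = y∉ i ∘ there

adversary-start : ∀ {k n} (s : Strategy k (suc n)) t → suc n + t * suc n ≤ k → Adversary s t (suc n)
adversary-start {k} {n} s t room
  with y , inj , y∉ ← fresh-colours (suc n) (usedColours s t)
                        (subst (λ l → suc n + l ≤ k) (sym (length-usedColours s t)) room) = record
  { A = λ _ → ⊤ ; A? = λ _ → yes tt ; inhabited = zero , tt ; y = y ; injective = inj
  ; L = λ _ → List.tabulate y
  ; y∈L = λ i _ → ∈-tabulate⁺ {f = y} i
  ; L⊆y = λ i _ a∈ → let j , a≡yj = ∈-tabulate⁻ {f = y} a∈ in j , tt , sym a≡yj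
  ; unique = λ i _ → tabulate⁺ {f = y} inj
  ; long = λ i _ → ≤-reflexive (sym (length-tabulate y))
  ; h = blackHistory s t
  ; consistent = λ w r → run-black s t (tabulate w)
      λ i → subst (_∉ usedColours s t) (sym (trans (lookup∘tabulate w i) (r .moved i))) (y∉ _)
  ; unguessed = All.map
      (λ g⊆ i _ g∈ → let j , g≡yj = ∈-tabulate⁻ {f = y} g∈ in y∉ j (subst (_∈ usedColours s t) g≡yj (g⊆ i)))
      (guesses-used s t)
  }

run-extend : ∀ {k n} (s : Strategy k n) y {P : Code k n × _ → Set} d t →
  Any P (run s y t) → Any P (run s y (d + t))
run-extend s y zero t p = p
run-extend s y (suc d) t p = Any.++⁺ˡ (run-extend s y d t p)

lower-bound : ∀ {k n} c → suc c * suc n ≤ k → ∀ m → m < suc c + n → ¬ Solvable k (suc n) m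
lower-bound {n = n} c room m m<  (s , solves)
  with d , m+d≡ ← m≤n⇒∃[o]m+o≡n (≤-pred m<) =
  adversary-wins (adversary-steps n (adversary-start s c room))
    λ y → subst (λ u → Any (λ p → proj₁ p ≡ y) (run s y u))
      (trans (+-comm d m) (trans m+d≡ (+-comm c n))) (run-extend s y d m (solves y))

-- The codebreaker

_≟ᶜ_ : (a b : Colour) → Dec (a ≡ b)
G ≟ᶜ G = yes refl
G ≟ᶜ Y = no λ ()
G ≟ᶜ B = no λ ()
Y ≟ᶜ G = no λ ()
Y ≟ᶜ Y = yes refl
Y ≟ᶜ B = no λ ()
B ≟ᶜ G = no λ ()
B ≟ᶜ Y = no λ ()
B ≟ᶜ B = yes refl

anyCode? : ∀ {k n} {P : Code k n → Set} → Decidable P → Dec (∃ P)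
anyCode? {n = zero} P? = map′ ([] ,_) (λ { ([] , p) → p }) (P? [])
anyCode? {n = suc n} P? = map′ (λ (a , x , p) → a ∷ x , p) (λ { (a ∷ x , p) → a , x , p })
  (any? λ a → anyCode? λ x → P? (a ∷ x))

Consistent : ∀ {k n} → Code k n → History k n → Set
Consistent w = All λ (g , π) → feedback g w ≡ π

consistent? : ∀ {k n} (h : History k n) → Decidable {A = Code k n} λ w → Consistent w h
consistent? h w = All.all? (λ (g , π) → ≡-dec _≟ᶜ_ (feedback g w) π) h

run-consistent : ∀ {k n} (s : Strategy k n) y t → Consistent y (run s y t)
run-consistent s y zero = All.[]
run-consistent s y (suc t) = All.++⁺ (run-consistent s y t) (refl All.∷ All.[])

length-run : ∀ {k n} (s : Strategy k n) y t → length (run s y t) ≡ t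
length-run s y zero = refl
length-run s y (suc t) = trans (length-++ (run s y t)) (trans (+-comm _ 1) (cong suc (length-run s y t)))

guess∈run : ∀ {k n} (s : Strategy k n) y {u t} → u < t → (s (run s y u) , feedback (s (run s y u)) y) ∈ run s y t
guess∈run s y {u} {suc t} u<1+t with m<1+n⇒m<n∨m≡n u<1+t
... | inj₁ u<t = ∈-++⁺ˡ (guess∈run s y u<t)
... | inj₂ refl = ∈-++⁺ʳ (run s y u) (here refl)

block : ∀ c n → Fin c → Code (c * n) n
block c n b = tabulate (combine b)

block-injective : ∀ c n (b : Fin c) → Injective _≡_ _≡_ (lookup (block c n b))
block-injective c n b {i} {j} eq = combine-injectiveʳ b i b j
  (trans (sym (lookup∘tabulate (combine b) i)) (trans eq (lookup∘tabulate (combine b) j)))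

in-block : ∀ c n (a : Fin (c * n)) → ∃[ b ] ∃[ p ] lookup (block c n b) p ≡ a
in-block c n a with b , p , refl ← combine-surjective {c} {n} a = b , p , lookup∘tabulate (combine b) p

record Play (c n : ℕ) (y : Code (suc c * n) n) : Set where
  field
    guess         : ℕ → Code (suc c * n) n
    guess-block   : ∀ b → guess (toℕ b) ≡ block (suc c) n b
    same-feedback : ∀ {u t} → u < t → suc c ≤ t → feedback (guess u) (guess t) ≡ feedback (guess u) y

  repeated⇒right : ∀ {u t} j → u < t → suc c ≤ t → lookup (guess u) j ≡ lookup (guess t) j →
    lookup (guess u) j ≡ lookup y j
  repeated⇒right {u} {t} j u<t c≤t = feedback-green (guess u) (guess t) y j (same-feedback u<t c≤t)

  right⇒stays-right : ∀ {u t} j → u ≤ t → suc c ≤ t → lookup (guess u) j ≡ lookup y j →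
    lookup (guess t) j ≡ lookup y j
  right⇒stays-right {u} {t} j u≤t c≤t right with m≤n⇒m<n∨m≡n u≤t
  ... | inj₂ refl = right
  ... | inj₁ u<t = trans (sym (feedback-green (guess u) y (guess t) j (sym (same-feedback u<t c≤t)) right)) right

  block-feedback : ∀ b {t} → suc c ≤ t → feedback (block (suc c) n b) (guess t) ≡ feedback (block (suc c) n b) y
  block-feedback b {t} c≤t = subst (λ x → feedback x (guess t) ≡ feedback x y) (guess-block b)
    (same-feedback (<-≤-trans (toℕ<n b) c≤t) c≤t)

  guess-colours : ∀ {t} → suc c ≤ t → ∀ j → ∃[ l ] lookup (guess t) j ≡ lookup y l
  guess-colours {t} c≤t j with b , p , eq ← in-block (suc c) n (lookup (guess t) j)
    with l , found ← feedback-colours (block (suc c) n b) (guess t) y p j (block-injective (suc c) n b)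
                       (block-feedback b c≤t) eq =
    l , trans (sym eq) found

  answer-colours : ∀ {t} → suc c ≤ t → ∀ j → ∃[ l ] lookup y j ≡ lookup (guess t) l
  answer-colours {t} c≤t j with b , p , eq ← in-block (suc c) n (lookup y j)
    with l , found ← feedback-colours (block (suc c) n b) y (guess t) p j (block-injective (suc c) n b)
                       (sym (block-feedback b c≤t)) eq =
    l , trans (sym eq) found

repeated-colour : ∀ c {n} (y : Code (suc c * suc (suc n)) (suc (suc n))) (play : Play c (suc (suc n)) y) →
  let open Play play in ∀ a b → a ≢ b → lookup y a ≡ lookup y b →
  ∀ i → ¬ lookup (guess (suc c + n)) i ≢ lookup y i
repeated-colour c {n} y play a b a≢b ya≡yb i wrong =
  let u , v , u<v , eq = pigeonhole (n<1+n (suc n)) λ v → punchOut (proj₁ (proj₂ (place v)) ∘ sym)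
      same = punchOut-injective (proj₁ (proj₂ (place u)) ∘ sym) (proj₁ (proj₂ (place v)) ∘ sym) eq
  in clash u v u<v (trans (proj₂ (proj₂ (place u))) (trans (cong (lookup y) same)
       (sym (proj₂ (proj₂ (place v))))))
  where
  open Play play
  column : Fin (suc (suc n)) → Fin (suc c * suc (suc n))
  column zero = lookup y i
  column (suc u) = lookup (guess (suc c + toℕ u)) i
  colours : ∀ v → ∃[ l ] column v ≡ lookup y l
  colours zero = i , refl
  colours (suc u) = guess-colours (m≤m+n (suc c) (toℕ u)) i
  place : ∀ v → ∃[ l ] (l ≢ b × column v ≡ lookup y l)
  place v with l , eq ← colours v with l ≟ b
  ... | yes refl = a , a≢b , trans eq (sym ya≡yb)
  ... | no l≢b = l , l≢b , eq
  never-right : ∀ u → column (suc u) ≢ lookup y i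
  never-right u right =
    wrong (right⇒stays-right i (+-monoʳ-≤ (suc c) (≤-pred (toℕ<n u))) (m≤m+n (suc c) n) right)
  clash : ∀ u v → u Fin.< v → column u ≢ column v
  clash zero (suc v) _ eq = never-right v (sym eq)
  clash (suc u) (suc v) (s≤s u<v) eq =
    never-right u (repeated⇒right i (+-monoʳ-< (suc c) u<v) (m≤m+n (suc c) (toℕ v)) eq)

distinct-colours : ∀ c {n} (y : Code (suc c * suc (suc n)) (suc (suc n))) (play : Play c (suc (suc n)) y) →
  let open Play play in
  Injective _≡_ _≡_ (lookup y) →
  ∀ i → ¬ lookup (guess (suc c + n)) i ≢ lookup y i
distinct-colours c {n} y play inj i wrong =
  let u , v , u<v , eq = pigeonhole (n<1+n (suc (suc n))) place in clash u v u<v eq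
  where
  open Play play
  home = in-block (suc c) (suc (suc n)) (lookup y i)
  b = proj₁ home
  round : Fin (suc (suc n)) → ℕ
  round zero = toℕ b
  round (suc u) = suc c + toℕ u
  tried : ∀ u → ∃[ l ] lookup y i ≡ lookup (guess (round u)) l
  tried zero = proj₁ (proj₂ home) , trans (sym (proj₂ (proj₂ home)))
    (cong (λ x → lookup x (proj₁ (proj₂ home))) (sym (guess-block b)))
  tried (suc u) = answer-colours (m≤m+n (suc c) (toℕ u)) i
  place : Fin (suc (suc (suc n))) → Fin (suc (suc n))
  place zero = i
  place (suc u) = proj₁ (tried u)
  round≤ : ∀ u → round u ≤ suc c + n
  round≤ zero = ≤-trans (<⇒≤ (toℕ<n b)) (m≤m+n (suc c) n)
  round≤ (suc u) = +-monoʳ-≤ (suc c) (≤-pred (toℕ<n u))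
  elsewhere : ∀ u → place (suc u) ≢ i
  elsewhere u eq = wrong (right⇒stays-right i (round≤ u) (m≤m+n (suc c) n)
    (trans (cong (lookup (guess (round u))) (sym eq)) (sym (proj₂ (tried u)))))
  increasing : ∀ u v → u Fin.< v → round u < round v × suc c ≤ round v
  increasing zero (suc v) _ = <-≤-trans (toℕ<n b) (m≤m+n (suc c) (toℕ v)) , m≤m+n (suc c) (toℕ v)
  increasing (suc u) (suc v) (s≤s u<v) = +-monoʳ-< (suc c) u<v , m≤m+n (suc c) (toℕ v)
  clash : ∀ u v → u Fin.< v → place u ≢ place v
  clash zero (suc v) _ eq = elsewhere v (sym eq)
  clash (suc u) (suc v) (s≤s u<v) eq = elsewhere u (inj (sym (trans (proj₂ (tried u))
    (repeated⇒right (place (suc u)) (proj₁ (increasing u v u<v)) (proj₂ (increasing u v u<v))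
      (trans (sym (proj₂ (tried u))) (trans (proj₂ (tried v)) (cong (lookup (guess (round v))) (sym eq))))))))

lookup-ext : ∀ {X : Set} {n} {x y : Vec X n} → (∀ i → lookup x i ≡ lookup y i) → x ≡ y
lookup-ext {x = x} {y} eq = trans (sym (tabulate∘lookup x)) (trans (tabulate-cong eq) (tabulate∘lookup y))

last-guess : ∀ c {n} (y : Code (suc c * suc (suc n)) (suc (suc n))) (play : Play c (suc (suc n)) y) →
  let open Play play in
  guess (suc c + n) ≡ y
last-guess c {n} y play = lookup-ext λ i → decidable-stable (lookup (guess (suc c + n)) i ≟ lookup y i) (right i)
  where
  open Play play
  right : ∀ i → ¬ lookup (guess (suc c + n)) i ≢ lookup y i
  right with any? (λ a → any? λ b → ¬? (a ≟ b) ×-dec (lookup y a ≟ lookup y b))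
  ... | yes (a , b , a≢b , ya≡yb) = repeated-colour c y play a b a≢b ya≡yb
  ... | no none = distinct-colours c y play λ {a} {b} ya≡yb →
     decidable-stable (a ≟ b) λ a≢b → none (a , b , a≢b , ya≡yb)

blocksThenConsistent : ∀ c n → Strategy (suc c * n) n
blocksThenConsistent c n h with length h <? suc c | anyCode? (consistent? h)
... | yes t<c | _ = block (suc c) n (fromℕ< t<c)
... | no _ | yes (w , _) = w
... | no _ | no _ = block (suc c) n zero

module _ (c : ℕ) {n : ℕ} (y : Code (suc c * n) n) where

  history : ℕ → History (suc c * n) n
  history = run (blocksThenConsistent c n) y

  guess : ℕ → Code (suc c * n) n
  guess t = blocksThenConsistent c n (history t)

  length-history : ∀ t → length (history t) ≡ t
  length-history = length-run (blocksThenConsistent c n) y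

  guess-block : ∀ b → guess (toℕ b) ≡ block (suc c) n b
  guess-block b with length (history (toℕ b)) <? suc c | anyCode? (consistent? (history (toℕ b)))
  ... | yes t<c | _ = cong (block (suc c) n) (toℕ-injective (trans (toℕ-fromℕ< t<c) (length-history (toℕ b))))
  ... | no t≮c | _ = contradiction (subst (_< suc c) (sym (length-history (toℕ b))) (toℕ<n b)) t≮c

  guess-consistent : ∀ t → suc c ≤ t → Consistent (guess t) (history t)
  guess-consistent t c≤t with length (history t) <? suc c | anyCode? (consistent? (history t))
  ... | yes t<c | _ = contradiction c≤t (<⇒≱ (subst (_< suc c) (length-history t) t<c))
  ... | no _ | yes (w , w-consistent) = w-consistent
  ... | no _ | no none = contradiction (y , run-consistent (blocksThenConsistent c n) y t) none

  guess∈history : ∀ {u t} → u < t → (guess u , feedback (guess u) y) ∈ history t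
  guess∈history = guess∈run (blocksThenConsistent c n) y

  play : Play c n y
  play = record
    { guess = guess
    ; guess-block = guess-block
    ; same-feedback = λ {u} {t} u<t c≤t → All.lookup (guess-consistent t c≤t) (guess∈history u<t) }

solved-by : ∀ c {n} (y : Code (suc c * n) n) {t} u → u < t → Play.guess (play c y) u ≡ y →
  Any (λ p → proj₁ p ≡ y) (run (blocksThenConsistent c n) y t)
solved-by c y u u<t solved = lose (guess∈history c y u<t) solved

solves-within : ∀ c n → SolvesWithin (blocksThenConsistent c (suc n)) (suc c + n)
solves-within c zero y =
  let b , p , eq = in-block (suc c) 1 (lookup y zero)
  in solved-by c y (toℕ b) (subst (toℕ b <_) (+-comm 0 (suc c)) (toℕ<n b))
       (trans (Play.guess-block (play c y) b) (lookup-ext λ { zero → single (block (suc c) 1 b) p eq }))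
  where
  single : ∀ (x : Code (suc c * 1) 1) {a} (p : Fin 1) → lookup x p ≡ a → lookup x zero ≡ a
  single x zero eq = eq
solves-within c (suc n) y = solved-by c y (suc c + n) (+-monoʳ-< (suc c) (n<1+n n)) (last-guess c y (play c y))

theorem2 : (n c : ℕ) → 1 ≤ n → 1 ≤ c → IsF (c * n) n (c + n ∸ 1)
theorem2 (suc n) (suc c) _ _ =
  (blocksThenConsistent c (suc n) ,
   subst (SolvesWithin (blocksThenConsistent c (suc n))) (sym (+-suc c n)) (solves-within c n)) ,
  λ m m< → lower-bound c ≤-refl m (subst (m <_) (+-suc c n) m<)
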